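{- For every integer $k\ge 1$, $\mathrm{Duck}_{k,1}=tb_{k-1}$, where $tb_{k-1}$ is the $(k-1)$-st weighted tennis ball number.
   Context: A 3D-Dyck word of length $3k$ is a word with $k$ letters X, $k$ letters Y and $k$ letters Z such that in every prefix the number of X's is at least the number of Y's, which is at least the number of Z's. $\mathrm{Duck}_{k,i}$ is the number of 3D-Dyck words of length $3k$ in which exactly $i$ of the Y's do not have an X immediately before them. Tennis ball process with $m$ rounds: start with an empty room and an empty lawn. In round $r=1,\dots,m$, put the balls numbered $2r-1$ and $2r$ into the room, then choose any one ball currently in the room and throw it onto the lawn. $TB_m$ is the set of all possible configurations of balls on the lawn after $m$ rounds, where a configuration is the set ($m$-element subset of $\{1,\dots,2m\}$) of numbers of the balls on the lawn, irrespective of the order in which they were thrown. The $m$-th weighted tennis ball number is $tb_m=\sum_{a\in TB_m}\sum_{b\in a} b$. (For $m=0$: $TB_0=\{\emptyset\}$ and $tb_0=0$.) -}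

module Defs where

open import Data.Bool using (_∨_)
open import Data.Fin using (Fin; toℕ)
open import Data.Fin.Properties using (any?)
open import Data.Fin.Subset using (Subset; inside; outside; ⊥; ⁅_⁆; _∈_; _∪_; _-_)
open import Data.Fin.Subset.Properties using (_∈?_; anySubset?)
open import Data.Bool.Properties using () renaming (_≟_ to _≟ᵇ_)
open import Data.List using (List; []; _∷_; length; map; filter; zip; inits; allFin; cartesianProductWith)
open import Data.List.Relation.Unary.All using (All; all?)
open import Data.Maybe using (Maybe; just; nothing)
open import Data.Maybe.Properties using () renaming (≡-dec to ≡-decᵐ)
open import Data.Nat using (ℕ; zero; suc; _*_; _∸_; _≤_; _≤?_; _≟_)
open import Data.Nat.ListAction using (sum)
open import Data.Product using (_×_; _,_; ∃)
open import Data.Vec using (Vec; []; _∷_; tabulate; toList)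
open import Data.Vec.Properties using () renaming (≡-dec to ≡-decᵛ)
open import Relation.Binary using (DecidableEquality)
open import Relation.Binary.PropositionalEquality using (_≡_; _≢_; refl)
open import Relation.Nullary using (Dec; yes; no; does; map′; _×-dec_; ¬?)
open import Relation.Unary using (Decidable)

-- Every vector of length n over the alphabet xs, each exactly once when xs
-- has no repetitions.
vectors : {A : Set} → List A → (n : ℕ) → List (Vec A n)
vectors xs zero    = [] ∷ []
vectors xs (suc n) = cartesianProductWith _∷_ xs (vectors xs n)

data Letter : Set where
  X Y Z : Letter

_≟ˡ_ : DecidableEquality Letter
X ≟ˡ X = yes refl
X ≟ˡ Y = no λ ()
X ≟ˡ Z = no λ ()
Y ≟ˡ X = no λ ()
Y ≟ˡ Y = yes refl
Y ≟ˡ Z = no λ ()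
Z ≟ˡ X = no λ ()
Z ≟ˡ Y = no λ ()
Z ≟ˡ Z = yes refl

Word : Set
Word = List Letter

words : ℕ → List Word
words n = map toList (vectors (X ∷ Y ∷ Z ∷ []) n)

#[_] : Letter → Word → ℕ
#[ c ] w = length (filter (_≟ˡ c) w)

Is3DDyck : ℕ → Word → Set
Is3DDyck k w =
  (#[ X ] w ≡ k × #[ Y ] w ≡ k × #[ Z ] w ≡ k) ×
  All (λ p → #[ Y ] p ≤ #[ X ] p × #[ Z ] p ≤ #[ Y ] p) (inits w)

is3DDyck? : (k : ℕ) → Decidable (Is3DDyck k)
is3DDyck? k w =
  (#[ X ] w ≟ k ×-dec #[ Y ] w ≟ k ×-dec #[ Z ] w ≟ k) ×-dec
  all? (λ p → #[ Y ] p ≤? #[ X ] p ×-dec #[ Z ] p ≤? #[ Y ] p) (inits w)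

-- Each letter of the word paired with the letter immediately before it
-- (nothing for the first letter).
withPredecessor : Word → List (Maybe Letter × Letter)
withPredecessor w = zip (nothing ∷ map just w) w

YNotAfterX : Maybe Letter × Letter → Set
YNotAfterX (before , c) = c ≡ Y × before ≢ just X

yNotAfterX? : Decidable YNotAfterX
yNotAfterX? (before , c) = c ≟ˡ Y ×-dec ¬? (≡-decᵐ _≟ˡ_ before (just X))

#YNotAfterX : Word → ℕ
#YNotAfterX w = length (filter yNotAfterX? (withPredecessor w))

Duck : ℕ → ℕ → ℕ
Duck k i =
  length (filter (λ w → is3DDyck? k w ×-dec #YNotAfterX w ≟ i) (words (3 * k)))

-- Balls are numbered from 1, so the ball with index b : Fin N carries the
-- number 1 + toℕ b.
number : {N : ℕ} → Fin N → ℕ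
number b = suc (toℕ b)

newBalls : {N : ℕ} → ℕ → Subset N
newBalls r = tabulate λ b → does (number b ≟ 2 * r ∸ 1) ∨ does (number b ≟ 2 * r)

-- Reachable r room lawn: after r rounds the room and the lawn can hold exactly
-- these balls.  N must be at least 2 * r for
-- every ball of these rounds to exist.
data Reachable {N : ℕ} : ℕ → Subset N → Subset N → Set where
  start : Reachable zero ⊥ ⊥
  throw : ∀ {r room lawn} → Reachable r room lawn →
          ∀ b → b ∈ room ∪ newBalls (suc r) →
          Reachable (suc r) ((room ∪ newBalls (suc r)) - b) (lawn ∪ ⁅ b ⁆)

_≟ˢ_ : {N : ℕ} → DecidableEquality (Subset N)
_≟ˢ_ = ≡-decᵛ _≟ᵇ_

reachable? : {N : ℕ} (r : ℕ) (room lawn : Subset N) → Dec (Reachable r room lawn)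
reachable? zero room lawn =
  map′ (λ { (refl , refl) → start }) (λ { start → refl , refl })
       (room ≟ˢ ⊥ ×-dec lawn ≟ˢ ⊥)
reachable? (suc r) room lawn =
  map′ (λ { (_ , _ , b , b∈ , refl , refl , reach) → throw reach b b∈ })
       (λ { (throw reach b b∈) → _ , _ , b , b∈ , refl , refl , reach })
       (anySubset? λ room′ → anySubset? λ lawn′ → any? λ b →
         b ∈? room′ ∪ newBalls (suc r) ×-dec
         room ≟ˢ ((room′ ∪ newBalls (suc r)) - b) ×-dec
         lawn ≟ˢ (lawn′ ∪ ⁅ b ⁆) ×-dec
         reachable? r room′ lawn′)

IsConfiguration : (m : ℕ) → Subset (2 * m) → Set
IsConfiguration m lawn = ∃ λ room → Reachable m room lawn

isConfiguration? : (m : ℕ) → Decidable (IsConfiguration m)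
isConfiguration? m lawn = anySubset? λ room → reachable? m room lawn

TB : (m : ℕ) → List (Subset (2 * m))
TB m = filter (isConfiguration? m) (vectors (inside ∷ outside ∷ []) (2 * m))

ballSum : {N : ℕ} → Subset N → ℕ
ballSum {N} a = sum (map number (filter (_∈? a) (allFin N)))

tb : ℕ → ℕ
tb m = sum (map ballSum (TB m))

{-# OPTIONS --safe #-}
module Submission where

-- Contract every factor XY of a 3D-Dyck word to an up-step and read every Z as
-- a down-step.  A word in which exactly one Y is not preceded by X has one
-- other X, somewhere before that Y; deleting this X and reading the Y as an
-- up-step gives a Dyck path of semilength k with one marked up-step.  If p steps
-- precede the marked one, there are p + 1 places for the X, of which the one
-- just before the Y is forbidden, so Duck k 1 is the sum over all Dyck paths of
-- the positions, counted from 0, of their up-steps.  The lawn configurations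
-- after m rounds are the m-element sets with at least s elements among
-- 1, …, 2s for all s ≤ m; reading balls on the lawn as up-steps, these are the
-- Dyck paths of semilength m + 1 without their first and last steps, and the
-- position of an up-step becomes the number of its ball.

open import Defs
open import Data.Bool using (Bool; true; false; T; if_then_else_)
open import Data.Bool.Properties using (T-≡; T-∨)
open import Data.Fin using (Fin; zero; suc; toℕ)
open import Data.Fin.Properties using (any?)
open import Data.Fin.Subset
  using (Subset; inside; outside; ⁅_⁆; ∣_∣; _∈_; _∉_; _⊆_; _∪_; _∩_; _-_)
open import Data.Fin.Subset.Properties
open import Data.List
  using (List; []; _∷_; _++_; map; filter; length; inits; zip; allFin; cartesianProductWith)
open import Data.List.Properties using (map-∘; map-cong; map-++; map-tabulate)
open import Data.List.Relation.Unary.All as All using (All; []; _∷_)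
import Data.List.Relation.Unary.All.Properties as All
open import Data.Maybe using (Maybe; just; nothing)
open import Data.Nat hiding (_/_; _%_)
open import Data.Nat.DivMod using (_/_; _%_; m≡m%n+[m/n]*n; m%n<n; m/n*n≤m)
open import Data.Nat.ListAction using (sum)
open import Data.Nat.ListAction.Properties using (sum-++)
open import Data.Nat.Properties
open import Data.Nat.Solver using (module +-*-Solver)
open import Data.Product using (_×_; _,_; proj₁; proj₂; ∃; ∃₂)
open import Data.Sum using (_⊎_; inj₁; inj₂; [_,_]′)
open import Data.Unit using (tt)
open import Data.Vec as Vec using (Vec; []; _∷_; toList; here; there)
open import Data.Vec.Properties using (lookup∘tabulate; []=⇒lookup; lookup⇒[]=)
open import Function using (_∘_; id; _⇔_; mk⇔; Equivalence)
open import Relation.Binary.PropositionalEquality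
open import Relation.Nullary using (does; yes; no; T?; contradiction; ¬?; _×-dec_)
open import Relation.Nullary.Decidable using (does-⇔)
open import Relation.Unary using (Decidable)

open +-*-Solver using (solve; _:+_; _:*_; _:=_; con)

private
  variable
    A : Set
    n : ℕ

-- Weighted sums over lists and vectors

sum-map-filter : {P : A → Set} (P? : Decidable P) (f : A → ℕ) (xs : List A) →
  sum (map f (filter P? xs)) ≡ sum (map (λ x → if does (P? x) then f x else 0) xs)
sum-map-filter P? f []       = refl
sum-map-filter P? f (x ∷ xs) with does (P? x)
... | true  = cong (f x +_) (sum-map-filter P? f xs)
... | false = sum-map-filter P? f xs

length≡sum : (xs : List A) → length xs ≡ sum (map (λ _ → 1) xs)
length≡sum []       = refl
length≡sum (x ∷ xs) = cong suc (length≡sum xs)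

sum-map-linear : ∀ k (f g : A → ℕ) xs →
  sum (map (λ x → k * f x + g x) xs) ≡ k * sum (map f xs) + sum (map g xs)
sum-map-linear k f g []       = sym (trans (+-identityʳ _) (*-zeroʳ k))
sum-map-linear k f g (x ∷ xs) = trans (cong (k * f x + g x +_) (sum-map-linear k f g xs))
  (solve 5 (λ k a b c d → k :* a :+ b :+ (k :* c :+ d) := k :* (a :+ c) :+ (b :+ d))
     refl k (f x) (g x) (sum (map f xs)) (sum (map g xs)))

sum-map-zero : ∀ {f : A → ℕ} xs → (∀ x → f x ≡ 0) → sum (map f xs) ≡ 0
sum-map-zero []       f≡0 = refl
sum-map-zero (x ∷ xs) f≡0 = cong₂ _+_ (f≡0 x) (sum-map-zero xs f≡0)

total : List A → (n : ℕ) → (Vec A n → ℕ) → ℕ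
total xs n f = sum (map f (vectors xs n))

total-cong : ∀ (xs : List A) n {f g : Vec A n → ℕ} → (∀ v → f v ≡ g v) → total xs n f ≡ total xs n g
total-cong xs n f≗g = cong sum (map-cong f≗g (vectors xs n))

total-zero : ∀ (xs : List A) n {f : Vec A n → ℕ} → (∀ v → f v ≡ 0) → total xs n f ≡ 0
total-zero xs n f≡0 = sum-map-zero (vectors xs n) f≡0

total-suc : ∀ (xs : List A) n (f : Vec A (suc n) → ℕ) →
  total xs (suc n) f ≡ sum (map (λ x → total xs n (f ∘ (x ∷_))) xs)
total-suc {A = A} xs n f = go xs
  where
  go : (ys : List A) → sum (map f (cartesianProductWith _∷_ ys (vectors xs n))) ≡
                       sum (map (λ x → total xs n (f ∘ (x ∷_))) ys)
  go []       = refl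
  go (y ∷ ys) = begin
    sum (map f (map (y ∷_) vs ++ ws))              ≡⟨ cong sum (map-++ f (map (y ∷_) vs) ws) ⟩
    sum (map f (map (y ∷_) vs) ++ map f ws)        ≡⟨ sum-++ (map f (map (y ∷_) vs)) (map f ws) ⟩
    sum (map f (map (y ∷_) vs)) + sum (map f ws)   ≡⟨ cong₂ _+_ (cong sum (sym (map-∘ vs))) (go ys) ⟩
    total xs n (f ∘ (y ∷_)) + sum (map (λ x → total xs n (f ∘ (x ∷_))) ys) ∎
    where
    open ≡-Reasoning
    vs = vectors xs n
    ws = cartesianProductWith _∷_ ys vs

-- Dyck paths

-- Suffixes of Dyck paths with u up-steps, starting at height q.
paths : ℕ → ℕ → ℕ
paths zero    q       = 1
paths (suc u) zero    = paths u 1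
paths (suc u) (suc q) = paths u (2 + q) + paths (suc u) q

-- The sum over these paths of the positions of their up-steps, counted from 1
-- and (in positions₀) from 0.
positions : ℕ → ℕ → ℕ
positions zero    q       = 0
-- The first step, an up-step, has position 1 and moves the `u` later up-steps on by one, so each
-- path gains `suc u`. A first step down moves all `suc u` up-steps on by one.
positions (suc u) zero    = suc u * paths u 1 + positions u 1
positions (suc u) (suc q) =
  (suc u * paths u (2 + q) + positions u (2 + q)) +
  (suc u * paths (suc u) q + positions (suc u) q)

positions₀ : ℕ → ℕ → ℕ
positions₀ zero    q       = 0
-- An up-step in front contributes 0, and the later positions counted from 0 are those of the
-- remaining path counted from 1.
positions₀ (suc u) zero    = positions u 1
positions₀ (suc u) (suc q) = positions u (2 + q) + positions (suc u) q

positions≡positions₀ : ∀ u q → positions u q ≡ positions₀ u q + u * paths u q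
positions≡positions₀ zero    q       = refl
positions≡positions₀ (suc u) zero    = +-comm (suc u * paths u 1) (positions u 1)
positions≡positions₀ (suc u) (suc q) =
  solve 5 (λ u a b c d → (u :* a :+ c) :+ (u :* b :+ d) := (c :+ d) :+ u :* (a :+ b))
    refl (suc u) (paths u (2 + q)) (paths (suc u) q) (positions u (2 + q)) (positions (suc u) q)

-- 3D-Dyck words

-- Here x is the number of X's still to come, p = #X − #Y and q = #Y − #Z so
-- far, b says whether the last letter was X, and i is the number of Y's without
-- an X before them still to come.
accepts : Word → (x p q : ℕ) (b : Bool) (i : ℕ) → Bool
accepts []      zero    zero    zero    b     zero    = true
accepts []      _       _       _       _     _       = false
accepts (X ∷ w) zero    p       q       b     i       = false
accepts (X ∷ w) (suc x) p       q       b     i       = accepts w x (suc p) q true i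
accepts (Y ∷ w) x       zero    q       b     i       = false
accepts (Y ∷ w) x       (suc p) q       true  i       = accepts w x p (suc q) false i
accepts (Y ∷ w) x       (suc p) q       false zero    = false
accepts (Y ∷ w) x       (suc p) q       false (suc i) = accepts w x p (suc q) false i
accepts (Z ∷ w) x       p       zero    b     i       = false
accepts (Z ∷ w) x       p       (suc q) b     i       = accepts w x p q false i

isX : Maybe Letter → Bool
isX (just X) = true
isX _        = false

-- The prefix condition for a word `w` read after a prefix with surpluses `p` of X's over Y's and
-- `q` of Y's over Z's.
Above : ℕ → ℕ → Word → Set
Above p q w = #[ Y ] w ≤ p + #[ X ] w × #[ Z ] w ≤ q + #[ Y ] w

-- Generalises `#YNotAfterX`, which is the case `nothing`, to a word that follows the letter `m`.
late : Maybe Letter → Word → ℕ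
late m w = length (filter yNotAfterX? (zip (m ∷ map just w) w))

-- Rephrases the test of the preceding letter through the boolean that `accepts` carries, so that
-- abstracting `isX m` settles both.
late-Y : ∀ m w → late m (Y ∷ w) ≡ (if isX m then late (just Y) w else suc (late (just Y) w))
late-Y (just X) w = refl
late-Y (just Y) w = refl
late-Y (just Z) w = refl
late-Y nothing  w = refl

-- What `accepts` decides. The Y's are counted relative to the X's and the Z's relative to the Y's,
-- matching the surpluses `p` and `q` that change by one with each letter read.
record Completes (x p q : ℕ) (m : Maybe Letter) (i : ℕ) (w : Word) : Set where
  constructor completes
  field
    #X≡      : #[ X ] w ≡ x
    #Y≡      : #[ Y ] w ≡ p + #[ X ] w
    #Z≡      : #[ Z ] w ≡ q + #[ Y ] w
    prefixes : All (Above p q) (inits w)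
    late≡    : late m w ≡ i

inits-∷⁺ : ∀ {P Q : Word → Set} {c} w → Q [] → (∀ {u} → P u → Q (c ∷ u)) →
           All P (inits w) → All Q (inits (c ∷ w))
inits-∷⁺ w q[] step ps = q[] ∷ All.map⁺ (All.map step ps)

inits-∷⁻ : ∀ {P Q : Word → Set} {c} w → (∀ {u} → Q (c ∷ u) → P u) →
           All Q (inits (c ∷ w)) → All P (inits w)
inits-∷⁻ w step (_ ∷ qs) = All.map step (All.map⁻ qs)

accepts⇒completes : ∀ w x p q m i → T (accepts w x p q (isX m) i) → Completes x p q m i w
accepts⇒completes [] zero zero zero m zero t =
  completes refl refl refl ((z≤n , z≤n) ∷ []) refl
accepts⇒completes (X ∷ w) (suc x) p q m i t
  with completes a b c d e ← accepts⇒completes w x (suc p) q (just X) i t =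
  completes (cong suc a) (trans b (sym (+-suc p _))) c
    (inits-∷⁺ w (z≤n , z≤n) (λ {u} (y , z) → subst (#[ Y ] u ≤_) (sym (+-suc p _)) y , z) d) e
accepts⇒completes (Y ∷ w) x (suc p) q m i t
  with isX m | late-Y m w | i
... | true  | late≡ | i
  with completes a b c d e ← accepts⇒completes w x p (suc q) (just Y) i t =
  completes a (cong suc b) (trans c (sym (+-suc q _)))
    (inits-∷⁺ w (z≤n , z≤n) (λ {u} (y , z) → s≤s y , subst (#[ Z ] u ≤_) (sym (+-suc q _)) z) d)
    (trans late≡ e)
... | false | late≡ | suc i
  with completes a b c d e ← accepts⇒completes w x p (suc q) (just Y) i t =
  completes a (cong suc b) (trans c (sym (+-suc q _)))
    (inits-∷⁺ w (z≤n , z≤n) (λ {u} (y , z) → s≤s y , subst (#[ Z ] u ≤_) (sym (+-suc q _)) z) d)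
    (trans late≡ (cong suc e))
accepts⇒completes (Z ∷ w) x p (suc q) m i t
  with completes a b c d e ← accepts⇒completes w x p q (just Z) i t =
  completes a b (cong suc c) (inits-∷⁺ w (z≤n , z≤n) (λ (y , z) → y , s≤s z) d) e

completes⇒accepts : ∀ w x p q m i → Completes x p q m i w → T (accepts w x p q (isX m) i)
completes⇒accepts [] zero zero zero m i (completes refl refl refl _ refl) = tt
completes⇒accepts (X ∷ w) (suc x) p q m i (completes a b c d e) =
  completes⇒accepts w x (suc p) q (just X) i
    (completes (suc-injective a) (trans b (+-suc p _)) c
      (inits-∷⁻ w (λ {u} (y , z) → subst (#[ Y ] u ≤_) (+-suc p _) y , z) d) e)
-- The one-letter prefix Y would need `1 ≤ 0`; likewise Z at `q = 0` below.
completes⇒accepts (Y ∷ w) x zero q m i (completes a b c (_ ∷ (() , _) ∷ _) e)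
completes⇒accepts (Y ∷ w) x (suc p) q m i (completes a b c d e)
  with isX m | late-Y m w | i
... | true  | late≡ | i = completes⇒accepts w x p (suc q) (just Y) i
    (completes a (suc-injective b) (trans c (+-suc q _))
      (inits-∷⁻ w (λ {u} (y , z) → s≤s⁻¹ y , subst (#[ Z ] u ≤_) (+-suc q _) z) d)
      (trans (sym late≡) e))
... | false | late≡ | zero with () ← trans (sym late≡) e
... | false | late≡ | suc i = completes⇒accepts w x p (suc q) (just Y) i
    (completes a (suc-injective b) (trans c (+-suc q _))
      (inits-∷⁻ w (λ {u} (y , z) → s≤s⁻¹ y , subst (#[ Z ] u ≤_) (+-suc q _) z) d)
      (suc-injective (trans (sym late≡) e)))
completes⇒accepts (Z ∷ w) x p zero m i (completes a b c (_ ∷ (_ , ()) ∷ _) e)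
completes⇒accepts (Z ∷ w) x p (suc q) m i (completes a b c d e) =
  completes⇒accepts w x p q (just Z) i
    (completes a b (suc-injective c) (inits-∷⁻ w (λ (y , z) → y , s≤s⁻¹ z) d) e)

-- Counting the completions of a prefix

letters : List Letter
letters = X ∷ Y ∷ Z ∷ []

indicator : Bool → ℕ
indicator b = if b then 1 else 0

completions : (x p q : ℕ) (b : Bool) (i n : ℕ) → ℕ
completions x p q b i n = total letters n λ v → indicator (accepts (toList v) x p q b i)

Duck≡completions : ∀ k i → Duck k i ≡ completions k 0 0 false i (3 * k)
Duck≡completions k i = begin
  length (filter P? (words (3 * k)))
    ≡⟨ length≡sum (filter P? (words (3 * k))) ⟩
  sum (map (λ _ → 1) (filter P? (words (3 * k))))
    ≡⟨ sum-map-filter P? (λ _ → 1) (words (3 * k)) ⟩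
  sum (map (indicator ∘ does ∘ P?) (map toList (vectors letters (3 * k))))
    ≡⟨ cong sum (map-∘ (vectors letters (3 * k))) ⟨
  total letters (3 * k) (indicator ∘ does ∘ P? ∘ toList)
    ≡⟨ total-cong letters (3 * k) (λ v → cong indicator (does-⇔ P⇔accepts (P? (toList v)) (T? _))) ⟩
  completions k 0 0 false i (3 * k) ∎
  where
  open ≡-Reasoning
  P? = λ w → is3DDyck? k w ×-dec #YNotAfterX w ≟ i
  P⇔accepts : ∀ {w} → (Is3DDyck k w × #YNotAfterX w ≡ i) ⇔ T (accepts w k 0 0 false i)
  P⇔accepts {w} = mk⇔
    (λ (((a , b , c) , d) , e) → completes⇒accepts w k 0 0 nothing i
      (completes a (trans b (sym a)) (trans c (sym b)) d e))
    (λ t → let completes a b c d e = accepts⇒completes w k 0 0 nothing i t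
           in ((a , trans b a , trans c (trans b a)) , d) , e)

-- Since `n` counts the letters after `c`, every legal choice of `c` reduces by computation to
-- `completions` in the next state.
completionsWith : Letter → (x p q : ℕ) (b : Bool) (i n : ℕ) → ℕ
completionsWith c x p q b i n =
  total letters n λ v → indicator (accepts (c ∷ toList v) x p q b i)

completions-suc : ∀ x p q b i n → completions x p q b i (suc n) ≡
  completionsWith X x p q b i n + (completionsWith Y x p q b i n + completionsWith Z x p q b i n)
completions-suc x p q b i n = trans (total-suc letters n _)
  (cong (completionsWith X x p q b i n +_)
    (cong (completionsWith Y x p q b i n +_) (+-identityʳ _)))

-- An X not followed at once by its Y uses up one of the late Y's.
accepts-surplus : ∀ w x p q b i → i + indicator b < p → accepts w x p q b i ≡ false
accepts-surplus []      zero    (suc p) q       b     i       lt = refl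
accepts-surplus []      (suc x) p       q       b     i       lt = refl
accepts-surplus (X ∷ w) zero    p       q       b     i       lt = refl
accepts-surplus (X ∷ w) (suc x) p       q       b     i       lt =
  accepts-surplus w x (suc p) q true i
    (subst (_< suc p) (+-comm 1 i) (s≤s (≤-<-trans (m≤m+n i _) lt)))
accepts-surplus (Y ∷ w) x       (suc p) q       true  i       lt =
  accepts-surplus w x p (suc q) false i
    (s≤s⁻¹ (subst (_< suc p) (trans (+-comm i 1) (cong suc (sym (+-identityʳ i)))) lt))
accepts-surplus (Y ∷ w) x       (suc p) q       false zero    lt = refl
accepts-surplus (Y ∷ w) x       (suc p) q       false (suc i) lt =
  accepts-surplus w x p (suc q) false i (s≤s⁻¹ lt)
accepts-surplus (Z ∷ w) x       p       zero    b     i       lt = refl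
accepts-surplus (Z ∷ w) x       p       (suc q) b     i       lt =
  accepts-surplus w x p q false i
    (≤-<-trans (≤-reflexive (+-identityʳ i)) (≤-<-trans (m≤m+n i _) lt))

completions-surplus : ∀ x {p} q b i n → i + indicator b < p → completions x p q b i n ≡ 0
completions-surplus x q b i n lt =
  total-zero letters n λ v → cong indicator (accepts-surplus (toList v) x _ q b i lt)

no-completions : ∀ n → total letters n (λ _ → 0) ≡ 0
no-completions n = total-zero letters n λ _ → refl

withX-surplus : ∀ x {p} q b i n → i < p → completionsWith X x p q b i n ≡ 0
withX-surplus zero    q b i n i<p = no-completions n
withX-surplus (suc x) {p} q b i n i<p =
  completions-surplus x q true i n (subst (_< suc p) (+-comm 1 i) (s≤s i<p))

withZ-surplus : ∀ x {p} q b i n → i < p → completionsWith Z x p q b i n ≡ 0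
withZ-surplus x zero    b i n i<p = no-completions n
withZ-surplus x (suc q) b i n i<p =
  completions-surplus x q false i n (subst (_< _) (sym (+-identityʳ i)) i<p)

-- Reading X or Z here would leave at least `suc i` X's that have missed their immediate Y, too many
-- for `i` late Y's.
completions-forcedY : ∀ x q i n →
  completions x (suc i) q true i (suc n) ≡ completions x i (suc q) false i n
completions-forcedY x q i n = trans (completions-suc x (suc i) q true i n)
  (cong₂ _+_ (withX-surplus x q true i n ≤-refl)
    (trans (cong (completions x i (suc q) false i n +_) (withZ-surplus x q true i n ≤-refl))
      (+-identityʳ _)))

-- Without late Y's each X begins a factor XY, an up-step, and each Z is a down-step. The length
-- counts three letters for each X to come and one Z for each unit of the height `q`.
completions-onTime : ∀ x q → completions x 0 q false 0 (x * 3 + q) ≡ paths x q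
withX-onTime : ∀ x q → completionsWith X (suc x) 0 q false 0 (2 + (x * 3 + q)) ≡ paths x (suc q)

completions-onTime zero    zero    = refl
completions-onTime zero    (suc q) = trans (completions-suc 0 0 (suc q) false 0 q)
  (cong₂ _+_ (no-completions q) (cong₂ _+_ (no-completions q) (completions-onTime zero q)))
completions-onTime (suc x) zero    = trans (completions-suc (suc x) 0 0 false 0 l)
  (trans (cong₂ _+_ (withX-onTime x 0) (cong₂ _+_ (no-completions l) (no-completions l)))
    (+-identityʳ _))
  where l = 2 + (x * 3 + 0)
completions-onTime (suc x) (suc q) = trans (completions-suc (suc x) 0 (suc q) false 0 l)
  (cong₂ _+_ (withX-onTime x (suc q)) (cong₂ _+_ (no-completions l)
    (trans (cong (λ t → completions (suc x) 0 q false 0 (2 + t)) (+-suc (x * 3) q))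
      (completions-onTime (suc x) q))))
  where l = 2 + (x * 3 + suc q)

withX-onTime x q = trans (completions-forcedY x q 0 (suc (x * 3 + q)))
  (trans (cong (completions x 0 (suc q) false 0) (sym (+-suc (x * 3) q)))
    (completions-onTime x (suc q)))

-- With one X unmatched, the late Y marks one of the up-steps.
completions-marked : ∀ x q →
  completions x 1 q false 1 (2 + (x * 3 + q)) ≡ suc x * paths (suc x) q
-- The new X must be followed at once by Y, which gives an unmarked first up-step; the mark lies on
-- one of the `x` up-steps after it.
withX-marked : ∀ x q b → completionsWith X x 1 q b 1 (1 + (x * 3 + q)) ≡ x * paths x (suc q)
withZ-marked : ∀ x q b →
  completionsWith Z x 1 (suc q) b 1 (1 + (x * 3 + suc q)) ≡ suc x * paths (suc x) q

completions-marked x q = trans (completions-suc x 1 q false 1 (suc (x * 3 + q)))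
  (trans (cong₂ _+_ (withX-marked x q false) (cong₂ _+_ Y≡ refl)) (rest q))
  where
  -- The late Y comes now: the marked up-step is the first one, and the rest of the word is on time.
  Y≡ : completionsWith Y x 1 q false 1 (suc (x * 3 + q)) ≡ paths x (suc q)
  Y≡ = trans (cong (completions x 0 (suc q) false 0) (sym (+-suc (x * 3) q)))
    (completions-onTime x (suc q))
  rest : ∀ q → x * paths x (suc q) +
           (paths x (suc q) + completionsWith Z x 1 q false 1 (suc (x * 3 + q))) ≡
         suc x * paths (suc x) q
  rest zero    = trans
    (cong (λ z → x * paths x 1 + (paths x 1 + z)) (no-completions (suc (x * 3 + 0))))
    (solve 2 (λ x c → x :* c :+ (c :+ con 0) := c :+ x :* c) refl x (paths x 1))
  rest (suc q) = trans
    (cong (λ z → x * paths x (2 + q) + (paths x (2 + q) + z)) (withZ-marked x q false))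
    (solve 3 (λ x c d → x :* c :+ (c :+ (d :+ x :* d)) := (c :+ d) :+ x :* (c :+ d))
      refl x (paths x (2 + q)) (paths (suc x) q))

withX-marked zero    q b = no-completions (suc q)
withX-marked (suc x) q b = trans (completions-forcedY x q 1 (3 + (x * 3 + q)))
  (trans (cong (λ l → completions x 1 (suc q) false 1 (2 + l)) (sym (+-suc (x * 3) q)))
    (completions-marked x (suc q)))

withZ-marked x q b = trans (cong (λ l → completions x 1 q false 1 (1 + l)) (+-suc (x * 3) q))
  (completions-marked x q)

-- The unmatched X is still to come. Unfolding the first steps adds one word for each path, marked
-- up-step and step before the mark at which that X can be inserted, which is the recursion of
-- `positions₀`.
completions-late : ∀ x q → completions x 0 q false 1 (x * 3 + q) ≡ positions₀ x q
-- If Y follows, the X is matched and `positions₀ x 1` remains. If X follows, the first X is the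
-- unmatched one, and the `x * paths x 1` marked paths turn `positions₀` into `positions`.
withX-late₀ : ∀ x →
  completionsWith X (suc x) 0 0 false 1 (2 + (x * 3 + 0)) ≡ positions x 1
-- At positive height the unmatched X may also be followed by Z, a down-step that leaves all `suc x`
-- up-steps for the mark.
withX-late₊ : ∀ x q →
  completionsWith X (suc x) 0 (suc q) false 1 (2 + (x * 3 + suc q)) ≡
  positions x (2 + q) + suc x * paths (suc x) q
withXY-late : ∀ x q →
  completionsWith Y x 1 q true 1 (1 + (x * 3 + q)) ≡ positions₀ x (suc q)

completions-late zero    zero    = refl
completions-late zero    (suc q) = trans (completions-suc 0 0 (suc q) false 1 q)
  (cong₂ _+_ (no-completions q) (cong₂ _+_ (no-completions q) (completions-late zero q)))
completions-late (suc x) zero    = trans (completions-suc (suc x) 0 0 false 1 l)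
  (trans (cong₂ _+_ (withX-late₀ x) (cong₂ _+_ (no-completions l) (no-completions l)))
    (+-identityʳ _))
  where l = 2 + (x * 3 + 0)
completions-late (suc x) (suc q) = trans (completions-suc (suc x) 0 (suc q) false 1 l)
  (trans (cong₂ _+_ (withX-late₊ x q) (cong₂ _+_ (no-completions l)
      (trans (cong (λ t → completions (suc x) 0 q false 1 (2 + t)) (+-suc (x * 3) q))
        (completions-late (suc x) q))))
    -- The words starting with XZ turn the `positions₀ (suc x) q` of those starting with Z into
    -- `positions (suc x) q`.
    (trans
      (solve 3 (λ a b c → a :+ b :+ c := a :+ (c :+ b)) refl
        (positions x (2 + q)) (suc x * paths (suc x) q) (positions₀ (suc x) q))
      (cong (positions x (2 + q) +_) (sym (positions≡positions₀ (suc x) q)))))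
  where l = 2 + (x * 3 + suc q)

withX-late₀ x = trans (completions-suc x 1 0 true 1 (1 + (x * 3 + 0)))
  (trans
    (cong₂ _+_ (withX-marked x 0 true)
      (cong₂ _+_ (withXY-late x 0) (no-completions (1 + (x * 3 + 0)))))
    (trans
      (solve 2 (λ a b → a :+ (b :+ con 0) := b :+ a) refl (x * paths x 1) (positions₀ x 1))
      (sym (positions≡positions₀ x 1))))

withX-late₊ x q = trans (completions-suc x 1 (suc q) true 1 (1 + (x * 3 + suc q)))
  (trans
    (cong₂ _+_ (withX-marked x (suc q) true)
      (cong₂ _+_ (withXY-late x (suc q)) (withZ-marked x q true)))
    (trans
      (solve 3 (λ a b c → a :+ (b :+ c) := (b :+ a) :+ c) refl
        (x * paths x (2 + q)) (positions₀ x (2 + q)) (suc x * paths (suc x) q))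
      (cong (_+ suc x * paths (suc x) q) (sym (positions≡positions₀ x (2 + q))))))

withXY-late x q = trans (cong (completions x 0 (suc q) false 1) (sym (+-suc (x * 3) q)))
  (completions-late x (suc q))

Duck₁≡positions₀ : ∀ k → Duck k 1 ≡ positions₀ k 0
Duck₁≡positions₀ k = trans (Duck≡completions k 1)
  (trans (cong (completions k 0 0 false 1) (trans (*-comm 3 k) (sym (+-identityʳ (k * 3)))))
    (completions-late k 0))

-- Lawns

sum-allFin-suc : ∀ n (f : Fin (suc n) → ℕ) →
  sum (map f (allFin (suc n))) ≡ f zero + sum (map (f ∘ suc) (allFin n))
sum-allFin-suc n f = cong (λ xs → f zero + sum xs)
  (trans (cong (map f) (sym (map-tabulate id suc))) (sym (map-∘ (allFin n))))

∣∣≡sum : (v : Subset n) → sum (map (λ b → indicator (does (b ∈? v))) (allFin n)) ≡ ∣ v ∣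
∣∣≡sum []                    = refl
∣∣≡sum {suc n} (inside  ∷ v) =
  trans (sum-allFin-suc n (λ b → indicator (does (b ∈? (inside ∷ v))))) (cong suc (∣∣≡sum v))
∣∣≡sum {suc n} (outside ∷ v) =
  trans (sum-allFin-suc n (λ b → indicator (does (b ∈? (outside ∷ v))))) (∣∣≡sum v)

-- A ball put in front raises the number of each ball of `v` by one and itself has the number 1.
ballSum-∷ : ∀ s (v : Subset n) → ballSum (s ∷ v) ≡ indicator s + (∣ v ∣ + ballSum v)
ballSum-∷ {n} s v = begin
  ballSum (s ∷ v)
    ≡⟨ sum-map-filter (_∈? (s ∷ v)) number (allFin (suc n)) ⟩
  sum (map (λ b → if does (b ∈? (s ∷ v)) then number b else 0) (allFin (suc n)))
    ≡⟨ sum-allFin-suc n _ ⟩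
  (if does (zero ∈? (s ∷ v)) then 1 else 0) +
  sum (map (λ b → if does (b ∈? v) then suc (number b) else 0) (allFin n))
    ≡⟨ cong₂ _+_ (head s) (trans (cong sum (map-cong shift (allFin n)))
         (sum-map-linear 1 (λ b → indicator (does (b ∈? v)))
            (λ b → if does (b ∈? v) then number b else 0) (allFin n))) ⟩
  indicator s +
  (1 * sum (map (λ b → indicator (does (b ∈? v))) (allFin n)) +
   sum (map (λ b → if does (b ∈? v) then number b else 0) (allFin n)))
    ≡⟨ cong (indicator s +_) (cong₂ _+_ (trans (*-identityˡ _) (∣∣≡sum v))
         (sym (sum-map-filter (_∈? v) number (allFin n)))) ⟩
  indicator s + (∣ v ∣ + ballSum v) ∎
  where
  open ≡-Reasoning
  head : ∀ s → (if does (zero ∈? (s ∷ v)) then 1 else 0) ≡ indicator s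
  head inside  = refl
  head outside = refl
  shift : ∀ b → (if does (b ∈? v) then suc (number b) else 0) ≡
                1 * indicator (does (b ∈? v)) + (if does (b ∈? v) then number b else 0)
  shift b with does (b ∈? v)
  ... | true  = refl
  ... | false = refl

-- A ball on the lawn is an up-step and any other ball a down-step.
isPath : Subset n → (u q : ℕ) → Bool
isPath []            zero    q       = true
isPath []            (suc u) q       = false
isPath (inside  ∷ v) zero    q       = false
isPath (inside  ∷ v) (suc u) q       = isPath v u (suc q)
isPath (outside ∷ v) u       zero    = false
isPath (outside ∷ v) u       (suc q) = isPath v u q

below : ℕ → Subset n
below {zero}  t       = []
below {suc n} zero    = outside ∷ below zero
below {suc n} (suc t) = inside ∷ below t

∈below⁺ : ∀ {t} {b : Fin n} → toℕ b < t → b ∈ below t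
∈below⁺ {b = zero}  (s≤s b<t) = here
∈below⁺ {b = suc b} (s≤s b<t) = there (∈below⁺ b<t)

∈below⁻ : ∀ {t} {b : Fin n} → b ∈ below t → toℕ b < t
∈below⁻ {t = suc t} {zero}  here       = s≤s z≤n
∈below⁻ {t = suc t} {suc b} (there b∈) = s≤s (∈below⁻ b∈)
∈below⁻ {t = zero}  {suc b} (there b∈) with () ← ∈below⁻ b∈

∩-below-mono : ∀ {v w : Subset n} {s t} → v ⊆ w → s ≤ t → ∣ v ∩ below s ∣ ≤ ∣ w ∩ below t ∣
∩-below-mono {v = v} {w} {s} v⊆w s≤t = p⊆q⇒∣p∣≤∣q∣ λ b∈ →
  let b∈v , b∈s = x∈p∩q⁻ v (below s) b∈
  in x∈p∩q⁺ (v⊆w b∈v , ∈below⁺ (<-≤-trans (∈below⁻ b∈s) s≤t))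

-- After `t` steps, `a` of them up, the height is `q + a - (t - a)`; that it is nonnegative is
-- written here without subtraction.
IsPath : (u q : ℕ) → Subset n → Set
IsPath {n} u q v = ∣ v ∣ ≡ u × (∀ t → t ≤ n → t ≤ q + ∣ v ∩ below t ∣ * 2)

isPath⇒IsPath : ∀ (v : Subset n) u q → T (isPath v u q) → IsPath u q v
isPath⇒IsPath []            zero    q       p = refl , λ t t≤0 → ≤-trans t≤0 z≤n
isPath⇒IsPath (inside  ∷ v) (suc u) q       p with isPath⇒IsPath v u (suc q) p
... | ∣v∣≡u , above = cong suc ∣v∣≡u , λ where
  zero    _         → z≤n
  (suc t) (s≤s t≤n) → ≤-trans (s≤s (above t t≤n))
    (≤-reflexive (trans (cong suc (sym (+-suc q _))) (sym (+-suc q _))))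
isPath⇒IsPath (outside ∷ v) u       (suc q) p with isPath⇒IsPath v u q p
... | ∣v∣≡u , above = ∣v∣≡u , λ where
  zero    _         → z≤n
  (suc t) (s≤s t≤n) → s≤s (above t t≤n)

∩-below-zero : (v : Subset n) → ∣ v ∩ below 0 ∣ ≡ 0
∩-below-zero []            = refl
∩-below-zero (inside  ∷ v) = ∩-below-zero v
∩-below-zero (outside ∷ v) = ∩-below-zero v

IsPath⇒isPath : ∀ (v : Subset n) u q → IsPath u q v → T (isPath v u q)
IsPath⇒isPath []            zero    q       (_ , _) = tt
IsPath⇒isPath (inside  ∷ v) (suc u) q       (∣v∣≡u , above) =
  IsPath⇒isPath v u (suc q) (suc-injective ∣v∣≡u , λ t t≤n →
    s≤s⁻¹ (≤-trans (above (suc t) (s≤s t≤n))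
      (≤-reflexive (trans (+-suc q _) (cong suc (+-suc q _))))))
-- A down-step from height 0 violates the bound at `t = 1`.
IsPath⇒isPath {suc n} (outside ∷ v) u zero (∣v∣≡u , above)
  with () ← subst (λ c → 1 ≤ c * 2) (∩-below-zero v) (above 1 (s≤s z≤n))
IsPath⇒isPath (outside ∷ v) u       (suc q) (∣v∣≡u , above) =
  IsPath⇒isPath v u q (∣v∣≡u , λ t t≤n → s≤s⁻¹ (above (suc t) (s≤s t≤n)))

-- Sums over the subsets that encode paths

sides : List Bool
sides = inside ∷ outside ∷ []

total-sides-suc : ∀ n (f : Subset (suc n) → ℕ) →
  total sides (suc n) f ≡ total sides n (f ∘ (inside ∷_)) + total sides n (f ∘ (outside ∷_))
total-sides-suc n f =
  trans (total-suc sides n f) (cong (total sides n (f ∘ (inside ∷_)) +_) (+-identityʳ _))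

pathCount : ∀ n u q → ℕ
pathCount n u q = total sides n λ v → indicator (isPath v u q)

pathSum : ∀ n u q → ℕ
pathSum n u q = total sides n λ v → if isPath v u q then ballSum v else 0

-- The missing last step is a down-step from height 1.
pathCount≡paths : ∀ n u q → suc n ≡ u * 2 + q → pathCount n u q ≡ paths u q
pathCount≡paths zero    zero    (suc zero)    refl = refl
pathCount≡paths (suc n) zero    (suc q)       eq   = trans (total-sides-suc n _)
  (cong₂ _+_ (total-zero sides n λ _ → refl) (pathCount≡paths n 0 q (suc-injective eq)))
pathCount≡paths (suc n) (suc u) zero          eq   = trans (total-sides-suc n _)
  (trans (cong₂ _+_ (pathCount≡paths n u 1 (trans (suc-injective eq) (sym (+-suc (u * 2) 0))))
      (total-zero sides n λ _ → refl))
    (+-identityʳ _))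
pathCount≡paths (suc n) (suc u) (suc q)       eq   = trans (total-sides-suc n _)
  (cong₂ _+_
    (pathCount≡paths n u (2 + q) (trans (suc-injective eq) (sym (+-suc (u * 2) (suc q)))))
    (pathCount≡paths n (suc u) q (trans (suc-injective eq) (cong suc (+-suc (u * 2) q)))))

-- By `ballSum-∷` the first step adds the same `k` on every path: one for each of the `u′` later
-- up-steps, and one more if it is itself an up-step.
pathSum-∷ : ∀ n s {u q u′ q′} k → (∀ (v : Subset n) → isPath (s ∷ v) u q ≡ isPath v u′ q′) →
  indicator s + u′ ≡ k →
  total sides n (λ v → if isPath (s ∷ v) u q then ballSum (s ∷ v) else 0) ≡
  k * pathCount n u′ q′ + pathSum n u′ q′
pathSum-∷ n s {u} {q} {u′} {q′} k step k≡ = trans (total-cong sides n pointwise)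
  (sum-map-linear k (λ v → indicator (isPath v u′ q′))
    (λ v → if isPath v u′ q′ then ballSum v else 0) (vectors sides n))
  where
  pointwise : ∀ v → (if isPath (s ∷ v) u q then ballSum (s ∷ v) else 0) ≡
    k * indicator (isPath v u′ q′) + (if isPath v u′ q′ then ballSum v else 0)
  pointwise v rewrite step v with isPath v u′ q′ | isPath⇒IsPath v u′ q′
  ... | false | _ = sym (trans (+-identityʳ _) (*-zeroʳ k))
  ... | true  | path = begin
    ballSum (s ∷ v)                       ≡⟨ ballSum-∷ s v ⟩
    indicator s + (∣ v ∣ + ballSum v)     ≡⟨ +-assoc (indicator s) ∣ v ∣ _ ⟨
    indicator s + ∣ v ∣ + ballSum v       ≡⟨ cong (λ c → indicator s + c + ballSum v) (proj₁ (path tt)) ⟩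
    indicator s + u′ + ballSum v          ≡⟨ cong (_+ ballSum v) (trans k≡ (sym (*-identityʳ k))) ⟩
    k * 1 + ballSum v ∎
    where open ≡-Reasoning

-- Splitting off the first step gives the recursion of `positions`, with `pathCount≡paths` supplying
-- the path counts in it.
pathSum≡positions : ∀ n u q → suc n ≡ u * 2 + q → pathSum n u q ≡ positions u q
pathSum≡positions zero    zero    (suc zero)    refl = refl
pathSum≡positions (suc n) zero    (suc q)       eq   = trans (total-sides-suc n _)
  (cong₂ _+_ (total-zero sides n λ _ → refl)
    (trans (pathSum-∷ n outside {q = suc q} 0 (λ _ → refl) refl)
      (pathSum≡positions n 0 q (suc-injective eq))))
pathSum≡positions (suc n) (suc u) zero          eq   = trans (total-sides-suc n _)
  (trans (cong₂ _+_
      (trans (pathSum-∷ n inside {suc u} {0} (suc u) (λ _ → refl) refl)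
        (cong₂ (λ c s → suc u * c + s) (pathCount≡paths n u 1 eq′) (pathSum≡positions n u 1 eq′)))
      (total-zero sides n λ _ → refl))
    (+-identityʳ _))
  where eq′ = trans (suc-injective eq) (sym (+-suc (u * 2) 0))
pathSum≡positions (suc n) (suc u) (suc q)       eq   = trans (total-sides-suc n _)
  (cong₂ _+_
    (trans (pathSum-∷ n inside {suc u} {suc q} (suc u) (λ _ → refl) refl)
      (cong₂ (λ c s → suc u * c + s)
        (pathCount≡paths n u (2 + q) eq′) (pathSum≡positions n u (2 + q) eq′)))
    (trans (pathSum-∷ n outside {suc u} {suc q} (suc u) (λ _ → refl) refl)
      (cong₂ (λ c s → suc u * c + s)
        (pathCount≡paths n (suc u) q eq″) (pathSum≡positions n (suc u) q eq″))))
  where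
  eq′ = trans (suc-injective eq) (sym (+-suc (u * 2) (suc q)))
  eq″ = trans (suc-injective eq) (cong suc (+-suc (u * 2) q))

-- Cardinalities of subsets

x∉p-x : ∀ (p : Subset n) x → x ∉ p - x
x∉p-x (inside  ∷ p) zero    ()
x∉p-x (outside ∷ p) zero    ()
x∉p-x (s ∷ p)       (suc x) (there x∈) = x∉p-x p x x∈

∣p∪⁅x⁆∣ : ∀ (p : Subset n) x → x ∉ p → ∣ p ∪ ⁅ x ⁆ ∣ ≡ suc ∣ p ∣
∣p∪⁅x⁆∣ (inside  ∷ p) zero    x∉ = contradiction here x∉
∣p∪⁅x⁆∣ (outside ∷ p) zero    x∉ = cong (suc ∘ ∣_∣) (∪-identityʳ p)
∣p∪⁅x⁆∣ (inside  ∷ p) (suc x) x∉ = cong suc (∣p∪⁅x⁆∣ p x (x∉ ∘ there))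
∣p∪⁅x⁆∣ (outside ∷ p) (suc x) x∉ = ∣p∪⁅x⁆∣ p x (x∉ ∘ there)

∣p∣<∣q∣⇒∃ : ∀ (p q : Subset n) → ∣ p ∣ < ∣ q ∣ → ∃ λ x → x ∈ q × x ∉ p
∣p∣<∣q∣⇒∃ p q lt with any? (λ x → x ∈? q ×-dec ¬? (x ∈? p))
... | yes found = found
... | no  none  = contradiction (p⊆q⇒∣p∣≤∣q∣ q⊆p) (<⇒≱ lt)
  where
  q⊆p : q ⊆ p
  q⊆p {x} x∈q with x ∈? p
  ... | yes x∈p = x∈p
  ... | no  x∉p = contradiction (x , x∈q , x∉p) none

⊆∧∣∣≡⇒≡ : ∀ {p q : Subset n} → p ⊆ q → ∣ p ∣ ≡ ∣ q ∣ → p ≡ q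
⊆∧∣∣≡⇒≡ {p = p} {q} p⊆q eq = ⊆-antisym p⊆q q⊆p
  where
  q⊆p : q ⊆ p
  q⊆p {x} x∈q with x ∈? p
  ... | yes x∈p = x∈p
  ... | no  x∉p = contradiction eq (<⇒≢ (p⊂q⇒∣p∣<∣q∣ (p⊆q , x , x∈q , x∉p)))

-- The tennis ball process

∈tabulate⇔ : ∀ {f : Fin n → Bool} {b} → b ∈ Vec.tabulate f ⇔ T (f b)
∈tabulate⇔ {f = f} {b} = mk⇔
  (λ b∈ → Equivalence.from T-≡ (trans (sym (lookup∘tabulate f b)) ([]=⇒lookup b∈)))
  (λ t → lookup⇒[]= b _ (trans (lookup∘tabulate f b) (Equivalence.to T-≡ t)))

-- The interval contains just the indices `r * 2` and `suc (r * 2)`, whose balls carry the numbers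
-- one higher.
∈newBalls⁺ : ∀ r {b : Fin n} → r * 2 ≤ toℕ b → toℕ b < suc r * 2 → b ∈ newBalls (suc r)
∈newBalls⁺ r {b} lo hi = Equivalence.from ∈tabulate⇔ (Equivalence.from T-∨ cases)
  where
  cases : T (number b ≡ᵇ 2 * suc r ∸ 1) ⊎ T (number b ≡ᵇ 2 * suc r)
  cases with m≤n⇒m<n∨m≡n lo
  ... | inj₂ eq = inj₁ (≡⇒≡ᵇ (number b) _
    (trans (cong suc (sym eq)) (cong pred (*-comm (suc r) 2))))
  ... | inj₁ lt = inj₂ (≡⇒≡ᵇ (number b) _ (trans (≤-antisym hi (s≤s lt)) (*-comm (suc r) 2)))

∈newBalls⁻ : ∀ r {b : Fin n} → b ∈ newBalls (suc r) → r * 2 ≤ toℕ b × toℕ b < suc r * 2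
∈newBalls⁻ r {b} b∈ = [ odd , even ]′ (Equivalence.to T-∨ (Equivalence.to ∈tabulate⇔ b∈))
  where
  odd : T (number b ≡ᵇ 2 * suc r ∸ 1) → r * 2 ≤ toℕ b × toℕ b < suc r * 2
  odd t = ≤-reflexive (sym eq) , s≤s (≤-trans (≤-reflexive eq) (n≤1+n _))
    where
    eq : toℕ b ≡ r * 2
    eq = suc-injective (trans (≡ᵇ⇒≡ (number b) _ t) (cong pred (*-comm 2 (suc r))))
  even : T (number b ≡ᵇ 2 * suc r) → r * 2 ≤ toℕ b × toℕ b < suc r * 2
  even t = ≤-trans (n≤1+n _) (≤-reflexive (sym eq)) , s≤s (≤-reflexive eq)
    where
    eq : toℕ b ≡ suc (r * 2)
    eq = suc-injective (trans (≡ᵇ⇒≡ (number b) _ t) (*-comm 2 (suc r)))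

-- An invariant of the process. `early` is the bound that characterises configurations; `disjoint`
-- and `seen` guarantee that a thrown ball is new to the lawn.
record Consistent (r : ℕ) (room lawn : Subset n) : Set where
  field
    ∣lawn∣   : ∣ lawn ∣ ≡ r
    early    : ∀ s → s ≤ r → s ≤ ∣ lawn ∩ below (s * 2) ∣
    disjoint : ∀ {b} → b ∈ room → b ∉ lawn
    seen     : ∀ {b} → b ∈ room ∪ lawn → toℕ b < r * 2

reachable⇒consistent : ∀ {r} {room lawn : Subset n} → Reachable r room lawn → Consistent r room lawn
reachable⇒consistent {n} start = record
  { ∣lawn∣   = ∣⊥∣≡0 n
  ; early    = λ { zero _ → z≤n }
  ; disjoint = λ _ → ∉⊥
  ; seen     = λ b∈ → contradiction ([ id , id ]′ (x∈p∪q⁻ _ _ b∈)) ∉⊥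
  }
reachable⇒consistent (throw {r} {room} {lawn} reach b b∈) = record
  { ∣lawn∣   = size
  ; early    = early′
  ; disjoint = λ {c} c∈ c∈′ → [ fresh (p─q⊆p _ ⁅ b ⁆ c∈) , (λ c∈b →
      x∉p-x _ b (subst (_∈ (room ∪ newBalls (suc r)) - b) (x∈⁅y⁆⇒x≡y b c∈b) c∈)) ]′
      (x∈p∪q⁻ lawn ⁅ b ⁆ c∈′)
  ; seen     = λ c∈ → [ seenNow ∘ p─q⊆p _ ⁅ b ⁆ , lawnSeen ]′ (x∈p∪q⁻ _ _ c∈)
  }
  where
  open Consistent (reachable⇒consistent reach)
  fresh : ∀ {c} → c ∈ room ∪ newBalls (suc r) → c ∉ lawn
  fresh c∈ c∈lawn with x∈p∪q⁻ room _ c∈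
  ... | inj₁ c∈room = disjoint c∈room c∈lawn
  ... | inj₂ c∈new  = <⇒≱ (seen (x∈p∪q⁺ (inj₂ c∈lawn))) (proj₁ (∈newBalls⁻ r c∈new))
  seenEarlier : ∀ {c} → c ∈ room ∪ lawn → toℕ c < suc r * 2
  seenEarlier c∈ = ≤-trans (seen c∈) (m≤n+m (r * 2) 2)
  seenNow : ∀ {c} → c ∈ room ∪ newBalls (suc r) → toℕ c < suc r * 2
  seenNow c∈ with x∈p∪q⁻ room _ c∈
  ... | inj₁ c∈room = seenEarlier (x∈p∪q⁺ (inj₁ c∈room))
  ... | inj₂ c∈new  = proj₂ (∈newBalls⁻ r c∈new)
  lawnSeen : ∀ {c} → c ∈ lawn ∪ ⁅ b ⁆ → toℕ c < suc r * 2
  lawnSeen c∈ with x∈p∪q⁻ lawn ⁅ b ⁆ c∈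
  ... | inj₁ c∈lawn = seenEarlier (x∈p∪q⁺ (inj₂ c∈lawn))
  ... | inj₂ c∈b    rewrite x∈⁅y⁆⇒x≡y b c∈b = seenNow b∈
  size : ∣ lawn ∪ ⁅ b ⁆ ∣ ≡ suc r
  size = trans (∣p∪⁅x⁆∣ lawn b (fresh b∈)) (cong suc ∣lawn∣)
  early′ : ∀ s → s ≤ suc r → s ≤ ∣ (lawn ∪ ⁅ b ⁆) ∩ below (s * 2) ∣
  early′ s s≤ with m≤n⇒m<n∨m≡n s≤
  ... | inj₁ (s≤s s≤r) = ≤-trans (early s s≤r) (∩-below-mono (p⊆p∪q {p = lawn} ⁅ b ⁆) ≤-refl)
  -- For `s = suc r` the whole lawn counts, since all its balls have been seen.
  ... | inj₂ refl = ≤-trans (≤-reflexive (sym size))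
    (p⊆q⇒∣p∣≤∣q∣ λ c∈ → x∈p∩q⁺ (c∈ , ∈below⁺ (lawnSeen c∈)))

-- In every round some ball of v seen so far is not yet on the lawn, and any
-- such ball may be thrown.
reach-within : ∀ {m} (v : Subset n) → (∀ s → s ≤ m → s ≤ ∣ v ∩ below (s * 2) ∣) →
  ∀ r → r ≤ m → ∃₂ λ room lawn → Reachable r room lawn × lawn ⊆ v ×
    (∀ b → toℕ b < r * 2 → b ∈ room ⊎ b ∈ lawn)
reach-within v early zero    r≤m = _ , _ , start , (λ b∈ → contradiction b∈ ∉⊥) , λ _ ()
reach-within v early (suc r) r<m
  with reach-within v early r (<⇒≤ r<m)
... | room , lawn , reach , lawn⊆v , complete
  with ∣p∣<∣q∣⇒∃ lawn (v ∩ below (suc r * 2))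
         (≤-trans (s≤s (≤-reflexive (Consistent.∣lawn∣ (reachable⇒consistent reach))))
           (early (suc r) r<m))
... | b , b∈ , b∉lawn = _ , _ , throw reach b (available b (∈below⁻ b<) b∉lawn) , within , complete′
  where
  b∈v = proj₁ (x∈p∩q⁻ v (below (suc r * 2)) b∈)
  b<  = proj₂ (x∈p∩q⁻ v (below (suc r * 2)) b∈)
  available : ∀ c → toℕ c < suc r * 2 → c ∉ lawn → c ∈ room ∪ newBalls (suc r)
  available c c< c∉lawn with toℕ c <? r * 2
  ... | yes c<r = x∈p∪q⁺ (inj₁ ([ id , (λ c∈lawn → contradiction c∈lawn c∉lawn) ]′ (complete c c<r)))
  ... | no  c≮r = x∈p∪q⁺ (inj₂ (∈newBalls⁺ r (≮⇒≥ c≮r) c<))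
  within : lawn ∪ ⁅ b ⁆ ⊆ v
  within c∈ with x∈p∪q⁻ lawn ⁅ b ⁆ c∈
  ... | inj₁ c∈lawn = lawn⊆v c∈lawn
  ... | inj₂ c∈b    rewrite x∈⁅y⁆⇒x≡y b c∈b = b∈v
  complete′ : ∀ c → toℕ c < suc r * 2 →
    c ∈ (room ∪ newBalls (suc r)) - b ⊎ c ∈ lawn ∪ ⁅ b ⁆
  complete′ c c< with c ∈? lawn ∪ ⁅ b ⁆
  ... | yes c∈ = inj₂ c∈
  ... | no  c∉ = inj₁ (x∈p∧x∉q⇒x∈p─q (available c c< (c∉ ∘ x∈p∪q⁺ ∘ inj₁)) (c∉ ∘ x∈p∪q⁺ ∘ inj₂))

-- The path starts at height 1 because the first up-step is left out. Forwards this is the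
-- invariant; backwards, a reachable lawn inside `v` with as many balls as `v` is `v`.
IsConfiguration⇔isPath : ∀ m (v : Subset (2 * m)) → IsConfiguration m v ⇔ T (isPath v m 1)
IsConfiguration⇔isPath m v = mk⇔ to from
  where
  to : IsConfiguration m v → T (isPath v m 1)
  to (room , reach) = IsPath⇒isPath v m 1 (∣lawn∣ , above)
    where
    open Consistent (reachable⇒consistent reach)
    -- The invariant speaks of even `t` only; the initial height 1 absorbs the remainder of an odd
    -- `t`.
    above : ∀ t → t ≤ 2 * m → t ≤ 1 + ∣ v ∩ below t ∣ * 2
    above t t≤ = begin
      t                                    ≡⟨ m≡m%n+[m/n]*n t 2 ⟩
      t % 2 + t / 2 * 2                    ≤⟨ +-monoˡ-≤ _ (s≤s⁻¹ (m%n<n t 2)) ⟩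
      1 + t / 2 * 2                        ≤⟨ +-monoʳ-≤ 1 (*-monoˡ-≤ 2 (early (t / 2) t/2≤m)) ⟩
      1 + ∣ v ∩ below (t / 2 * 2) ∣ * 2    ≤⟨ +-monoʳ-≤ 1 (*-monoˡ-≤ 2 (∩-below-mono {v = v} id (m/n*n≤m t 2))) ⟩
      1 + ∣ v ∩ below t ∣ * 2              ∎
      where
      open ≤-Reasoning
      t/2≤m : t / 2 ≤ m
      t/2≤m = *-cancelʳ-≤ (t / 2) m 2 (≤-trans (m/n*n≤m t 2) (≤-trans t≤ (≤-reflexive (*-comm 2 m))))
  from : T (isPath v m 1) → IsConfiguration m v
  from p with ∣v∣≡m , above ← isPath⇒IsPath v m 1 p
    with room , lawn , reach , lawn⊆v , _ ← reach-within {m = m} v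
           -- From `s * 2 ≤ 1 + a * 2` follows `s * 2 < suc a * 2`, hence `s ≤ a`.
           (λ s s≤m → s≤s⁻¹ (*-cancelʳ-< 2 s (suc _)
             (s≤s (above (s * 2) (≤-trans (*-monoˡ-≤ 2 s≤m) (≤-reflexive (*-comm m 2)))))))
           m ≤-refl
    with refl ← ⊆∧∣∣≡⇒≡ lawn⊆v
           (trans (Consistent.∣lawn∣ (reachable⇒consistent reach)) (sym ∣v∣≡m)) = room , reach

tb≡pathSum : ∀ m → tb m ≡ pathSum (2 * m) m 1
tb≡pathSum m = trans (sum-map-filter (isConfiguration? m) ballSum (vectors sides (2 * m)))
  (total-cong sides (2 * m) λ v → cong (if_then ballSum v else 0)
    (does-⇔ (IsConfiguration⇔isPath m v) (isConfiguration? m v) (T? _)))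

proposition5p4 : (k : ℕ) → k ≥ 1 → Duck k 1 ≡ tb (k ∸ 1)
proposition5p4 (suc m) _ = begin
  Duck (suc m) 1          ≡⟨ Duck₁≡positions₀ (suc m) ⟩
  -- By definition this is `positions₀ (suc m) 0`: a Dyck path begins with an up-step, at position
  -- 0.
  positions m 1           ≡⟨ pathSum≡positions (2 * m) m 1 1+2m≡m*2+1 ⟨
  pathSum (2 * m) m 1     ≡⟨ tb≡pathSum m ⟨
  tb m                    ∎
  where
  open ≡-Reasoning
  1+2m≡m*2+1 : suc (2 * m) ≡ m * 2 + 1
  1+2m≡m*2+1 = trans (+-comm 1 (2 * m)) (cong (_+ 1) (*-comm 2 m))
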